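{- Let $n,c$ be positive integers, $b\in\{1,2,\dots,n-1\}$, and $k=c\cdot n+b$. Then $c+n-1\le F(k,n)\le c+n$.
   Context: Clear Mastermind with $n\ge 1$ positions and $k\ge 1$ codes: write $[k]=\{1,\dots,k\}$. A codemaker fixes a secret answer $y=(y_1,\dots,y_n)\in[k]^n$. In each round the codebreaker submits a guess $x\in[k]^n$ (any string, chosen adaptively from previous guesses and feedback) and receives feedback $\pi(x,y)\in\{\mathrm{G},\mathrm{Y},\mathrm{B}\}^n$ defined as follows: for every position $i$ with $x_i=y_i$, $\pi_i=\mathrm{G}$. Let $M$ be the multiset $\{y_i : x_i\ne y_i\}$ of answer codes at non-G positions. Then scan the non-G positions $j$ in increasing order: if $x_j$ currently occurs in $M$, set $\pi_j=\mathrm{Y}$ and remove one copy of $x_j$ from $M$; otherwise set $\pi_j=\mathrm{B}$. The codebreaker finds the answer in $m$ rounds if her $m$-th guess equals $y$. $F(k,n)$ is the least $m$ such that the codebreaker has a strategy that, for every answer $y\in[k]^n$, makes a guess equal to $y$ within the first $m$ rounds. -}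

module Defs where

open import Data.Nat using (ℕ; zero; suc)
open import Data.Fin using (Fin; _≟_)
open import Data.Vec using (Vec; []; _∷_)
open import Data.List using (List; []; _∷_; _++_; [_])
open import Data.List.Relation.Unary.Any using (Any)
open import Data.Maybe using (Maybe; just; nothing)
open import Data.Product using (_×_; _,_)
open import Relation.Nullary using (yes; no)
open import Relation.Binary.PropositionalEquality using (_≡_)

data Colour : Set where
  G Y B : Colour

Word : ℕ → ℕ → Set
Word k n = Vec (Fin k) n

Feedback : ℕ → Set
Feedback n = Vec Colour n

-- The multiset M = { y_i : x_i ≠ y_i }, as a list (order irrelevant).
nonG : ∀ {k n} → Word k n → Word k n → List (Fin k)
nonG [] [] = []
nonG (x ∷ xs) (y ∷ ys) with x ≟ y
... | yes _ = nonG xs ys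
... | no _  = y ∷ nonG xs ys

removeOne : ∀ {k} → Fin k → List (Fin k) → Maybe (List (Fin k))
removeOne c [] = nothing
removeOne c (d ∷ ds) with c ≟ d
... | yes _ = just ds
... | no _ with removeOne c ds
...   | just ds' = just (d ∷ ds')
...   | nothing  = nothing

scan : ∀ {k n} → List (Fin k) → Word k n → Word k n → Feedback n
scan M [] [] = []
scan M (x ∷ xs) (y ∷ ys) with x ≟ y
... | yes _ = G ∷ scan M xs ys
... | no _ with removeOne x M
...   | just M' = Y ∷ scan M' xs ys
...   | nothing = B ∷ scan M xs ys

-- π(x, y): feedback for guess x against answer y.
feedback : ∀ {k n} → Word k n → Word k n → Feedback n
feedback x y = scan (nonG x y) x y

-- A history: the previous guesses with their feedback, in chronological order.
History : ℕ → ℕ → Set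
History k n = List (Word k n × Feedback n)

Strategy : ℕ → ℕ → Set
Strategy k n = History k n → Word k n

play : ∀ {k n} → Strategy k n → Word k n → ℕ → History k n → List (Word k n)
play s y zero h = []
play s y (suc m) h = s h ∷ play s y m (h ++ [ (s h , feedback (s h) y) ])

WinsWithin : ∀ {k n} → Strategy k n → ℕ → Set
WinsWithin {k} {n} s m = ∀ (y : Word k n) → Any (_≡ y) (play s y m [])

{-# OPTIONS --safe #-}
module Submission where

-- Lower bound.  The adversary answers all B in the first c − 1 rounds, which leaves n
-- codes never guessed, and takes the answer to be an arrangement of these n codes.  He
-- maintains a set A of positions and an arrangement y such that no guess so far is
-- green on A, and every code still possible at a position of A is placed on A by y.
-- After a guess some arrangement on A avoids it, by a Hall-type argument, once A is
-- shrunk suitably; A stays nonempty as long as fewer than n codes have been excluded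
-- at each position.  The feedback depends only on the green positions and on the
-- multiset of codes, so it is the same for all arrangements which remain.
--
-- Upper bound.  The first c + 1 guesses try all the codes, and reveal the set L of
-- codes which occur in the answer.  If |L| < n, guessing all but one of them at all
-- positions takes at most n − 2 rounds and leaves the answer as the last guess.  If
-- |L| = n, the answer is an arrangement of L.  Then a code is located by testing it at
-- all positions but one.  Each of n − 2 rounds locates one code and has one position to
-- spare, used to test one further code u at a new position; with the position where u
-- was first tried, this makes n − 1 tests of u, so only one code is not located.

open import Defs
open import Data.Nat using (ℕ; zero; suc; _+_; _*_; _∸_; _≤_; _<_; z≤n; s≤s)
open import Data.Nat.DivMod using (_/_; _%_; _mod_; m%n<n; m≡m%n+[m/n]*n; m<n*o⇒m/o<n)
import Data.Nat.Properties as ℕₚ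
open import Data.Nat.Induction using (Acc; acc; <-wellFounded)
open import Data.Empty using (⊥)
open import Data.Bool using (if_then_else_)
open import Data.Fin using (Fin; zero; suc; _≟_; toℕ; fromℕ; fromℕ<; inject₁; punchIn; punchOut)
open import Data.Fin.Properties
  using (any?; pigeonhole; <⇒≢; fromℕ<-toℕ; toℕ-fromℕ<; toℕ<n; toℕ-injective; punchIn-punchOut)
open import Data.Fin.Relation.Unary.Top using (view; ‵fromℕ; ‵inject₁)
open import Data.Fin.Subset using (Subset; inside; outside; _∈_; _∉_; _⊆_; _─_; _-_; ⊤; ∣_∣; Nonempty)
open import Data.Fin.Subset.Properties
  using (_∈?_; ∈⊤; x∈⁅x⁆; p─q⊆p; x∈p∧x∉q⇒x∈p─q; x∈p∧x≢y⇒x∈p-y; x∈p⇒∣p-x∣<∣p∣)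
open import Data.List as List using (List; []; _∷_; _++_; [_]; length; allFin)
open import Data.List.Membership.Propositional using () renaming (_∈_ to _∈ₗ_; _∉_ to _∉ₗ_)
open import Data.List.Membership.Propositional.Properties using (∈-allFin; ∈-map⁺; ∈-filter⁺; ∈-filter⁻; ∈-++⁺ˡ; ∈-++⁺ʳ)
import Data.List.Membership.Propositional.Properties as Listₘ using (∈-lookup)
import Data.List.Membership.DecPropositional as DecMembership
import Data.List.Properties as Listₚ
open import Data.List.Relation.Unary.All as All using (All; []; _∷_)
import Data.List.Relation.Unary.All.Properties as Allₚ
open import Data.List.Relation.Unary.AllPairs using ([]; _∷_)
open import Data.List.Relation.Unary.Unique.Propositional using (Unique)
import Data.List.Relation.Unary.Unique.Propositional.Properties as Uniqueₚ
open import Data.List.Relation.Unary.Any as Any using (Any; here; there)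
open import Data.List.Relation.Unary.Any.Properties using (lookup-index)
open import Data.Maybe using (just; nothing)
open import Data.Product using (_×_; Σ; ∃; _,_; proj₁; proj₂)
open import Data.Sum using (_⊎_; inj₁; inj₂; [_,_]′)
open import Data.Vec using ([]; _∷_; lookup; replicate; tabulate; toList; _[_]≔_; here; there)
import Data.Vec.Properties as Vecₚ
open import Data.Vec.Properties using (lookup∘update; lookup∘update′; length-toList)
open import Data.Vec.Membership.Propositional.Properties using (∈-lookup; ∈-toList⁺)
open import Function using (_∘_; id)
open import Relation.Nullary using (¬_; Dec; yes; no; does; contradiction)
open import Relation.Nullary.Decidable using (_×-dec_; ¬?; map′; decidable-stable)
open import Relation.Binary.PropositionalEquality
  using (_≡_; _≢_; refl; sym; trans; cong; cong₂; subst; module ≡-Reasoning)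

-- Counting codes, and what the feedback depends on.

δ : ∀ {k} → Fin k → Fin k → ℕ
δ a c = if does (a ≟ c) then 1 else 0

δ-refl : ∀ {k} (a : Fin k) → δ a a ≡ 1
δ-refl a with a ≟ a
... | yes _ = refl
... | no a≢a = contradiction refl a≢a

δ-≢ : ∀ {k} {a c : Fin k} → a ≢ c → δ a c ≡ 0
δ-≢ {a = a} {c} a≢c with a ≟ c
... | yes a≡c = contradiction a≡c a≢c
... | no _ = refl

count : ∀ {k} → Fin k → List (Fin k) → ℕ
count a [] = 0
count a (c ∷ cs) = δ a c + count a cs

occ : ∀ {k n} → Fin k → Word k n → ℕ
occ a y = count a (toList y)

occ-positive : ∀ {k n} (y : Word k n) i → 0 < occ (lookup y i) y
occ-positive (c ∷ y) zero rewrite δ-refl c = s≤s z≤n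
occ-positive (c ∷ y) (suc i) = ℕₚ.≤-trans (occ-positive y i) (ℕₚ.m≤n+m _ (δ (lookup y i) c))

positive-occ : ∀ {k n} {a : Fin k} (y : Word k n) → 0 < occ a y → ∃ λ i → lookup y i ≡ a
positive-occ {a = a} (c ∷ y) p with a ≟ c
... | yes a≡c = zero , sym a≡c
... | no _ = let i , e = positive-occ y p in suc i , e

removeOne-nothing : ∀ {k} (c : Fin k) M → removeOne c M ≡ nothing → count c M ≡ 0
removeOne-nothing c [] eq = refl
removeOne-nothing c (d ∷ M) eq with c ≟ d
... | no _ with removeOne c M in eq′
...   | nothing = removeOne-nothing c M eq′

removeOne-just : ∀ {k} (c : Fin k) M {M′} → removeOne c M ≡ just M′ →
  ∀ a → count a M ≡ δ a c + count a M′
removeOne-just c (d ∷ M) eq a with c ≟ d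
removeOne-just c (d ∷ M) refl a | yes refl = refl
removeOne-just c (d ∷ M) eq a | no _ with removeOne c M in eq′
removeOne-just c (d ∷ M) refl a | no _ | just M′ = begin
  δ a d + count a M            ≡⟨ cong (δ a d +_) (removeOne-just c M eq′ a) ⟩
  δ a d + (δ a c + count a M′) ≡⟨ ℕₚ.+-assoc (δ a d) _ _ ⟨
  δ a d + δ a c + count a M′   ≡⟨ cong (_+ count a M′) (ℕₚ.+-comm (δ a d) _) ⟩
  δ a c + δ a d + count a M′   ≡⟨ ℕₚ.+-assoc (δ a c) _ _ ⟩
  δ a c + (δ a d + count a M′) ∎
  where open ≡-Reasoning

SameGreens : ∀ {k n} → Word k n → Word k n → Word k n → Set
SameGreens x y y′ = ∀ i →
  (lookup x i ≡ lookup y i → lookup x i ≡ lookup y′ i) ×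
  (lookup x i ≡ lookup y′ i → lookup x i ≡ lookup y i)

greens : ∀ {k n} → Fin k → Word k n → Word k n → ℕ
greens a [] [] = 0
greens a (x ∷ xs) (y ∷ ys) with x ≟ y
... | yes _ = δ a x + greens a xs ys
... | no _ = greens a xs ys

greens-cong : ∀ {k n} (a : Fin k) (x y y′ : Word k n) → SameGreens x y y′ →
  greens a x y ≡ greens a x y′
greens-cong a [] [] [] same = refl
greens-cong a (x ∷ xs) (y ∷ ys) (y′ ∷ ys′) same with x ≟ y | x ≟ y′
... | yes _ | yes _ = cong (δ a x +_) (greens-cong a xs ys ys′ (same ∘ suc))
... | yes e | no ¬e = contradiction (proj₁ (same zero) e) ¬e
... | no ¬e | yes e = contradiction (proj₂ (same zero) e) ¬e
... | no _ | no _ = greens-cong a xs ys ys′ (same ∘ suc)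

-- Each position of `y` that holds `a` is either green or puts a copy of `a` into M, so the greens
-- and the counts of `y` determine M as a multiset.
greens+nonG : ∀ {k n} (a : Fin k) (x y : Word k n) →
  greens a x y + count a (nonG x y) ≡ occ a y
greens+nonG a [] [] = refl
greens+nonG a (x ∷ xs) (y ∷ ys) with x ≟ y
... | yes refl = trans (ℕₚ.+-assoc (δ a x) _ _) (cong (δ a x +_) (greens+nonG a xs ys))
... | no _ = begin
  greens a xs ys + (δ a y + count a (nonG xs ys)) ≡⟨ ℕₚ.+-assoc (greens a xs ys) _ _ ⟨
  greens a xs ys + δ a y + count a (nonG xs ys)   ≡⟨ cong (_+ count a (nonG xs ys)) (ℕₚ.+-comm (greens a xs ys) _) ⟩
  δ a y + greens a xs ys + count a (nonG xs ys)   ≡⟨ ℕₚ.+-assoc (δ a y) _ _ ⟩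
  δ a y + (greens a xs ys + count a (nonG xs ys)) ≡⟨ cong (δ a y +_) (greens+nonG a xs ys) ⟩
  δ a y + occ a ys ∎
  where open ≡-Reasoning

-- The scan consults M only through whether a count is positive, and removing the same code from
-- both lists keeps their counts equal.
scan-cong : ∀ {k n} M M′ (x y y′ : Word k n) → (∀ a → count a M ≡ count a M′) →
  SameGreens x y y′ → scan M x y ≡ scan M′ x y′
scan-cong M M′ [] [] [] M≈M′ same = refl
scan-cong M M′ (x ∷ xs) (y ∷ ys) (y′ ∷ ys′) M≈M′ same with x ≟ y | x ≟ y′
... | yes _ | yes _ = cong (G ∷_) (scan-cong M M′ xs ys ys′ M≈M′ (same ∘ suc))
... | yes e | no ¬e = contradiction (proj₁ (same zero) e) ¬e
... | no ¬e | yes e = contradiction (proj₂ (same zero) e) ¬e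
... | no _ | no _ with removeOne x M in eq | removeOne x M′ in eq′
...   | just N | just N′ = cong (Y ∷_) (scan-cong N N′ xs ys ys′
          (λ a → ℕₚ.+-cancelˡ-≡ (δ a x) _ _ (trans (sym (removeOne-just x M eq a))
            (trans (M≈M′ a) (removeOne-just x M′ eq′ a)))) (same ∘ suc))
...   | nothing | nothing = cong (B ∷_) (scan-cong M M′ xs ys ys′ M≈M′ (same ∘ suc))
...   | just N | nothing with () ← trans (cong (_+ count x N) (sym (δ-refl x)))
          (trans (sym (removeOne-just x M eq x)) (trans (M≈M′ x) (removeOne-nothing x M′ eq′)))
...   | nothing | just N with () ← trans (cong (_+ count x N) (sym (δ-refl x)))
          (trans (sym (removeOne-just x M′ eq′ x)) (trans (sym (M≈M′ x)) (removeOne-nothing x M eq)))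

feedback-cong : ∀ {k n} (x y y′ : Word k n) → SameGreens x y y′ → (∀ a → occ a y ≡ occ a y′) →
  feedback x y ≡ feedback x y′
feedback-cong x y y′ same y≈y′ = scan-cong _ _ x y y′
  (λ a → ℕₚ.+-cancelˡ-≡ (greens a x y) _ _ (begin
    greens a x y + count a (nonG x y)   ≡⟨ greens+nonG a x y ⟩
    occ a y                             ≡⟨ y≈y′ a ⟩
    occ a y′                            ≡⟨ greens+nonG a x y′ ⟨
    greens a x y′ + count a (nonG x y′) ≡⟨ cong (_+ count a (nonG x y′)) (greens-cong a x y y′ same) ⟨
    greens a x y + count a (nonG x y′)  ∎)) same
  where open ≡-Reasoning

-- What can be read off the feedback.

scan-G⁻ : ∀ {k n} M (x y : Word k n) i → lookup (scan M x y) i ≡ G → lookup x i ≡ lookup y i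
scan-G⁻ M (x ∷ xs) (y ∷ ys) i eq with x ≟ y
scan-G⁻ M (x ∷ xs) (y ∷ ys) zero eq | yes e = e
scan-G⁻ M (x ∷ xs) (y ∷ ys) (suc i) eq | yes e = scan-G⁻ M xs ys i eq
... | no _ with removeOne x M
scan-G⁻ M (x ∷ xs) (y ∷ ys) (suc i) eq | no _ | just N = scan-G⁻ N xs ys i eq
scan-G⁻ M (x ∷ xs) (y ∷ ys) (suc i) eq | no _ | nothing = scan-G⁻ M xs ys i eq

scan-G⁺ : ∀ {k n} M (x y : Word k n) i → lookup x i ≡ lookup y i → lookup (scan M x y) i ≡ G
scan-G⁺ M (x ∷ xs) (y ∷ ys) i eq with x ≟ y
scan-G⁺ M (x ∷ xs) (y ∷ ys) zero eq | yes e = refl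
scan-G⁺ M (x ∷ xs) (y ∷ ys) (suc i) eq | yes e = scan-G⁺ M xs ys i eq
... | no _ with removeOne x M
scan-G⁺ M (x ∷ xs) (y ∷ ys) zero eq | no ¬e | _ = contradiction eq ¬e
scan-G⁺ M (x ∷ xs) (y ∷ ys) (suc i) eq | no _ | just N = scan-G⁺ N xs ys i eq
scan-G⁺ M (x ∷ xs) (y ∷ ys) (suc i) eq | no _ | nothing = scan-G⁺ M xs ys i eq

-- Until some copy of `a` gets Y, removing other codes keeps the count of `a` in M. Hence position
-- `j`, or an earlier copy of `a`, is marked G or Y.
scan-nonB⁺ : ∀ {k n} {a : Fin k} M (x y : Word k n) j → 0 < count a M → lookup x j ≡ a →
  ∃ λ i → lookup x i ≡ a × lookup (scan M x y) i ≢ B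
scan-nonB⁺ {a = a} M (x ∷ xs) (y ∷ ys) j 0<M eq with x ≟ y
scan-nonB⁺ M (x ∷ xs) (y ∷ ys) zero 0<M eq | yes _ = zero , eq , λ ()
scan-nonB⁺ M (x ∷ xs) (y ∷ ys) (suc j) 0<M eq | yes _ =
  let i , e , nb = scan-nonB⁺ M xs ys j 0<M eq in suc i , e , nb
... | no _ with removeOne x M in eq′
scan-nonB⁺ {a = a} M (x ∷ xs) (y ∷ ys) j 0<M eq | no _ | just N with x ≟ a
... | yes x≡a = zero , x≡a , λ ()
scan-nonB⁺ M (x ∷ xs) (y ∷ ys) zero 0<M eq | no _ | just N | no x≢a = contradiction eq x≢a
scan-nonB⁺ {a = a} M (x ∷ xs) (y ∷ ys) (suc j) 0<M eq | no _ | just N | no x≢a =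
  let M≡N = trans (removeOne-just x M eq′ a) (cong (_+ count a N) (δ-≢ (x≢a ∘ sym)))
      i , e , nb = scan-nonB⁺ N xs ys j (subst (0 <_) M≡N 0<M) eq in suc i , e , nb
scan-nonB⁺ M (x ∷ xs) (y ∷ ys) zero 0<M refl | no _ | nothing =
  contradiction (removeOne-nothing x M eq′) (ℕₚ.>⇒≢ 0<M)
scan-nonB⁺ M (x ∷ xs) (y ∷ ys) (suc j) 0<M eq | no _ | nothing =
  let i , e , nb = scan-nonB⁺ M xs ys j 0<M eq in suc i , e , nb

-- A Y at `i` means that its code was still in the list when the scan came there, and the list only
-- shrinks.
scan-nonB⁻ : ∀ {k n} M (x y : Word k n) i → lookup (scan M x y) i ≢ B →
  lookup y i ≡ lookup x i ⊎ 0 < count (lookup x i) M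
scan-nonB⁻ M (x ∷ xs) (y ∷ ys) i nb with x ≟ y
scan-nonB⁻ M (x ∷ xs) (y ∷ ys) zero nb | yes e = inj₁ (sym e)
scan-nonB⁻ M (x ∷ xs) (y ∷ ys) (suc i) nb | yes e = scan-nonB⁻ M xs ys i nb
... | no _ with removeOne x M in eq
scan-nonB⁻ M (x ∷ xs) (y ∷ ys) zero nb | no _ | just N
  rewrite removeOne-just x M eq x | δ-refl x = inj₂ (s≤s z≤n)
scan-nonB⁻ M (x ∷ xs) (y ∷ ys) (suc i) nb | no _ | just N with scan-nonB⁻ N xs ys i nb
... | inj₁ e = inj₁ e
... | inj₂ p = inj₂ (subst (0 <_) (sym (removeOne-just x M eq _))
                (ℕₚ.≤-trans p (ℕₚ.m≤n+m _ (δ (lookup xs i) x))))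
scan-nonB⁻ M (x ∷ xs) (y ∷ ys) zero nb | no _ | nothing = contradiction refl nb
scan-nonB⁻ M (x ∷ xs) (y ∷ ys) (suc i) nb | no _ | nothing = scan-nonB⁻ M xs ys i nb

feedback-match : ∀ {k n} (x y y′ : Word k n) → feedback x y ≡ feedback x y′ → ∀ i →
  lookup x i ≡ lookup y i → lookup x i ≡ lookup y′ i
feedback-match x y y′ eq i e =
  scan-G⁻ _ x y′ i (trans (cong (λ f → lookup f i) (sym eq)) (scan-G⁺ _ x y i e))

nonG-occurs⁺ : ∀ {k n} (x y : Word k n) i →
  lookup x i ≡ lookup y i ⊎ 0 < count (lookup y i) (nonG x y)
nonG-occurs⁺ (x ∷ xs) (y ∷ ys) i with x ≟ y
nonG-occurs⁺ (x ∷ xs) (y ∷ ys) zero | yes e = inj₁ e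
nonG-occurs⁺ (x ∷ xs) (y ∷ ys) (suc i) | yes _ = nonG-occurs⁺ xs ys i
nonG-occurs⁺ (x ∷ xs) (y ∷ ys) zero | no _ rewrite δ-refl y = inj₂ (s≤s z≤n)
nonG-occurs⁺ (x ∷ xs) (y ∷ ys) (suc i) | no _ with nonG-occurs⁺ xs ys i
... | inj₁ e = inj₁ e
... | inj₂ p = inj₂ (ℕₚ.≤-trans p (ℕₚ.m≤n+m _ (δ (lookup ys i) y)))

nonG-occurs⁻ : ∀ {k n} {a : Fin k} (x y : Word k n) → 0 < count a (nonG x y) →
  ∃ λ i → lookup y i ≡ a
nonG-occurs⁻ {a = a} x y p = positive-occ y (subst (0 <_) (greens+nonG a x y)
  (ℕₚ.≤-trans p (ℕₚ.m≤n+m _ (greens a x y))))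

feedback-nonB⁻ : ∀ {k n} (x y : Word k n) i → lookup (feedback x y) i ≢ B →
  ∃ λ l → lookup y l ≡ lookup x i
feedback-nonB⁻ x y i nb with scan-nonB⁻ (nonG x y) x y i nb
... | inj₁ e = i , e
... | inj₂ p = nonG-occurs⁻ x y p

feedback-nonB⁺ : ∀ {k n} (x y : Word k n) j i → lookup x j ≡ lookup y i →
  ∃ λ l → lookup x l ≡ lookup y i × lookup (feedback x y) l ≢ B
feedback-nonB⁺ x y j i eq with nonG-occurs⁺ x y i
... | inj₁ e = i , e , λ b → contradiction (trans (sym (scan-G⁺ (nonG x y) x y i e)) b) λ ()
... | inj₂ p = scan-nonB⁺ (nonG x y) x y j p eq

-- A guessed code that occurs in `y` earns some non-B mark, and the same mark against `y′` shows
-- that the code occurs there too.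
feedback-occurs : ∀ {k n} (x y y′ : Word k n) → feedback x y ≡ feedback x y′ → ∀ j i →
  lookup x j ≡ lookup y i → ∃ λ l → lookup y′ l ≡ lookup y i
feedback-occurs x y y′ eq j i e =
  let l , xl , nb = feedback-nonB⁺ x y j i e
      m , ym = feedback-nonB⁻ x y′ l (subst (λ f → lookup f l ≢ B) eq nb)
  in m , trans ym xl

feedback-allB : ∀ {k n} (x y : Word k n) → (∀ i j → lookup x i ≢ lookup y j) →
  feedback x y ≡ replicate n B
feedback-allB x y disjoint = allB (feedback x y) decide
  where
  allB : ∀ {n} (f : Feedback n) → (∀ i → lookup f i ≡ B) → f ≡ replicate n B
  allB [] h = refl
  allB (b ∷ f) h = cong₂ _∷_ (h zero) (allB f (h ∘ suc))
  decide : ∀ i → lookup (feedback x y) i ≡ B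
  decide i with lookup (feedback x y) i in eq
  ... | B = refl
  ... | G = contradiction (proj₂ (feedback-nonB⁻ x y i λ b → contradiction (trans (sym eq) b) λ ()))
              (disjoint i _ ∘ sym)
  ... | Y = contradiction (proj₂ (feedback-nonB⁻ x y i λ b → contradiction (trans (sym eq) b) λ ()))
              (disjoint i _ ∘ sym)

-- Swaps and rearrangements.

swap : ∀ {k n} → Fin n → Fin n → Word k n → Word k n
swap i j y = (y [ i ]≔ lookup y j) [ j ]≔ lookup y i

lookup-swapʳ : ∀ {k n} i j (y : Word k n) → lookup (swap i j y) j ≡ lookup y i
lookup-swapʳ i j y = lookup∘update j (y [ i ]≔ lookup y j) (lookup y i)

lookup-swapˡ : ∀ {k n} i j (y : Word k n) → lookup (swap i j y) i ≡ lookup y j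
lookup-swapˡ i j y with i ≟ j
... | yes refl = lookup-swapʳ i i y
... | no i≢j = trans (lookup∘update′ i≢j (y [ i ]≔ lookup y j) (lookup y i))
                     (lookup∘update i y (lookup y j))

lookup-swap-other : ∀ {k n} {i j l} (y : Word k n) → l ≢ i → l ≢ j →
  lookup (swap i j y) l ≡ lookup y l
lookup-swap-other {i = i} {j} y l≢i l≢j =
  trans (lookup∘update′ l≢j (y [ i ]≔ lookup y j) (lookup y i)) (lookup∘update′ l≢i y (lookup y j))

-- The additive form avoids truncated subtraction: a copy of the old code is traded for one of `c`.
occ-update : ∀ {k n} a (y : Word k n) i c →
  occ a (y [ i ]≔ c) + δ a (lookup y i) ≡ occ a y + δ a c
occ-update a (d ∷ y) zero c = begin
  δ a c + occ a y + δ a d   ≡⟨ ℕₚ.+-comm (δ a c + occ a y) _ ⟩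
  δ a d + (δ a c + occ a y) ≡⟨ cong (δ a d +_) (ℕₚ.+-comm (δ a c) _) ⟩
  δ a d + (occ a y + δ a c) ≡⟨ ℕₚ.+-assoc (δ a d) _ _ ⟨
  δ a d + occ a y + δ a c   ∎
  where open ≡-Reasoning
occ-update a (d ∷ y) (suc i) c = trans (ℕₚ.+-assoc (δ a d) _ _)
  (trans (cong (δ a d +_) (occ-update a y i c)) (sym (ℕₚ.+-assoc (δ a d) _ _)))

occ-swap : ∀ {k n} a i j (y : Word k n) → occ a (swap i j y) ≡ occ a y
occ-swap a i j y = ℕₚ.+-cancelʳ-≡ (δ a (lookup y j)) _ _ (begin
  occ a (swap i j y) + δ a (lookup y j) ≡⟨ cong (λ c → occ a (swap i j y) + δ a c) z[j]≡y[j] ⟨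
  occ a (swap i j y) + δ a (lookup z j) ≡⟨ occ-update a z j (lookup y i) ⟩
  occ a z + δ a (lookup y i)            ≡⟨ occ-update a y i (lookup y j) ⟩
  occ a y + δ a (lookup y j)            ∎)
  where
  open ≡-Reasoning
  z = y [ i ]≔ lookup y j
  z[j]≡y[j] : lookup z j ≡ lookup y j
  z[j]≡y[j] with j ≟ i
  ... | yes refl = lookup∘update j y (lookup y j)
  ... | no j≢i = lookup∘update′ j≢i y (lookup y j)

x∈p─q⇒x∉q : ∀ {n} {x : Fin n} (p q : Subset n) → x ∈ p ─ q → x ∉ q
x∈p─q⇒x∉q (_ ∷ p) (inside ∷ q) (there x∈) (there x∈q) = x∈p─q⇒x∉q p q x∈ x∈q
x∈p─q⇒x∉q (_ ∷ p) (outside ∷ q) (there x∈) (there x∈q) = x∈p─q⇒x∉q p q x∈ x∈q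

x∈p-y⇒x≢y : ∀ {n} {x y : Fin n} (p : Subset n) → x ∈ p - y → x ≢ y
x∈p-y⇒x≢y {y = y} p x∈ refl = x∈p─q⇒x∉q p _ x∈ (x∈⁅x⁆ y)

-- `occs` concerns the whole word; `covers` keeps on `A` the codes that `y` places there, so that
-- closedness survives.
record Rearrangement {k n} (A : Subset n) (y z : Word k n) : Set where
  field
    occs   : ∀ a → occ a z ≡ occ a y
    covers : ∀ {l} → l ∈ A → ∃ λ m → m ∈ A × lookup z m ≡ lookup y l

rearrangement-refl : ∀ {k n} {A : Subset n} {y : Word k n} → Rearrangement A y y
rearrangement-refl = record { occs = λ _ → refl ; covers = λ l∈A → _ , l∈A , refl }

rearrangement-swap : ∀ {k n} {A : Subset n} {y z : Word k n} {i j} → i ∈ A → j ∈ A →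
  Rearrangement A y z → Rearrangement A y (swap i j z)
rearrangement-swap {z = z} {i} {j} i∈A j∈A r = record
  { occs = λ a → trans (occ-swap a i j z) (occs a)
  ; covers = λ l∈A → let m , m∈A , e = covers l∈A
                         m′ , m′∈A , e′ = moved m m∈A in m′ , m′∈A , trans e′ e }
  where
  open Rearrangement r
  moved : ∀ m → m ∈ _ → ∃ λ m′ → m′ ∈ _ × lookup (swap i j z) m′ ≡ lookup z m
  moved m m∈A with m ≟ i | m ≟ j
  ... | yes refl | _ = j , j∈A , lookup-swapʳ i j z
  ... | no _ | yes refl = i , i∈A , lookup-swapˡ i j z
  ... | no m≢i | no m≢j = m , m∈A , lookup-swap-other z m≢i m≢j

-- Hall-type repair of an arrangement.

-- Alternating paths: from a bad position i of A, either a path of E returns to the code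
-- of i, and i is repaired, or the positions reached without i are again closed.
module Matching {k n} (E : Fin n → Fin k → Set) (E? : ∀ i c → Dec (E i c))
                (neighbour : ∀ i → ∃ (E i)) where

  Closed : Subset n → Word k n → Set
  Closed A y = ∀ {i c} → i ∈ A → E i c → ∃ λ l → l ∈ A × lookup y l ≡ c

  Kept : Subset n → Word k n → Word k n → Set
  Kept A y z = ∀ l → lookup z l ≡ lookup y l ⊎ (l ∈ A × E l (lookup z l))

  -- `Bad` bounds the positions of `part` that may still hold a forbidden code; the empty predicate
  -- means a full repair. `kept` controls the positions dropped from `A`, about which `good` says
  -- nothing.
  record Repair (A : Subset n) (y : Word k n) (Bad : Fin n → Set) : Set where
    field
      word     : Word k n
      part     : Subset n
      nonempty : Nonempty part
      sub      : part ⊆ A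
      closed   : Closed part word
      occs     : ∀ a → occ a word ≡ occ a y
      kept     : Kept A y word
      good     : ∀ {l} → l ∈ part → E l (lookup word l) ⊎ (Bad l × lookup word l ≡ lookup y l)

  module Search {A : Subset n} {y : Word k n} (A-closed : Closed A y)
                {i : Fin n} (i∈A : i ∈ A) (bad : ¬ E i (lookup y i)) where

    -- An alternating path from i to j frees the code of i at j; the swaps along it
    -- have not touched U yet.
    Reached : Subset n → Fin n → Set
    Reached U j = ∃ λ z → Rearrangement A y z × lookup z j ≡ lookup y i ×
      (∀ l → l ≡ j ⊎ (l ≢ i × lookup z l ≡ lookup y l) ⊎ (l ∈ A × E l (lookup z l))) ×
      (∀ {l} → l ∈ U → lookup z l ≡ lookup y l)

    reached-weaken : ∀ {U V j} → V ⊆ U → Reached U j → Reached V j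
    reached-weaken V⊆U (z , r , e , moves , fixed) = z , r , e , moves , fixed ∘ V⊆U

    -- Swapping `j` and `m` gives `j` an allowed code and passes the code of `i` on to `m`. As `m`
    -- is in `U`, the word `z` still has there the code of `y`.
    reached-step : ∀ {U j m} → j ∈ A → j ∉ U → m ∈ A → m ∈ U → E j (lookup y m) →
      Reached U j → Reached (U - m) m
    reached-step {U} {j} {m} j∈A j∉U m∈A m∈U Ejm (z , r , e , moves , fixed) =
      swap j m z , rearrangement-swap j∈A m∈A r , trans (lookup-swapʳ j m z) e , moves′ , fixed′
      where
      Ej : E j (lookup (swap j m z) j)
      Ej = subst (E j) (sym (trans (lookup-swapˡ j m z) (fixed m∈U))) Ejm
      moves′ : ∀ l → l ≡ m ⊎ (l ≢ i × lookup (swap j m z) l ≡ lookup y l) ⊎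
        (l ∈ A × E l (lookup (swap j m z) l))
      moves′ l with l ≟ m | l ≟ j
      ... | yes l≡m | _ = inj₁ l≡m
      ... | no _ | yes refl = inj₂ (inj₂ (j∈A , Ej))
      ... | no l≢m | no l≢j rewrite lookup-swap-other z l≢j l≢m with moves l
      ...   | inj₁ l≡j = contradiction l≡j l≢j
      ...   | inj₂ h = inj₂ h
      fixed′ : ∀ {l} → l ∈ U - m → lookup (swap j m z) l ≡ lookup y l
      fixed′ {l} l∈ = trans
        (lookup-swap-other z (λ { refl → j∉U (p─q⊆p U _ l∈) }) (x∈p-y⇒x≢y U l∈))
        (fixed (p─q⊆p U _ l∈))

    -- Since `j` accepts the code of `i`, which it holds in `z`, every position changed along the
    -- path has an allowed code, and `i` is one of them.
    augment : ∀ {U j} → j ∈ A → E j (lookup y i) → Reached U j → Repair A y (_≢ i)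
    augment {j = j} j∈A Eji (z , r , e , moves , _) = record
      { word = z ; part = A ; nonempty = i , i∈A ; sub = id
      ; closed = λ l∈A Elc → let m , m∈A , ym = A-closed l∈A Elc
                                 m′ , m′∈A , zm′ = covers m∈A in m′ , m′∈A , trans zm′ ym
      ; occs = occs
      ; kept = λ l → kept′ l (moves l)
      ; good = λ {l} _ → good′ l (moves l) }
      where
      open Rearrangement r
      Ej : E j (lookup z j)
      Ej = subst (E j) (sym e) Eji
      kept′ : ∀ l → _ → lookup z l ≡ lookup y l ⊎ (l ∈ A × E l (lookup z l))
      kept′ l (inj₁ refl) = inj₂ (j∈A , Ej)
      kept′ l (inj₂ (inj₁ (_ , eq))) = inj₁ eq
      kept′ l (inj₂ (inj₂ h)) = inj₂ h
      good′ : ∀ l → _ → E l (lookup z l) ⊎ (l ≢ i × lookup z l ≡ lookup y l)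
      good′ l (inj₁ refl) = inj₁ Ej
      good′ l (inj₂ (inj₁ h)) = inj₂ h
      good′ l (inj₂ (inj₂ (_ , El))) = inj₁ El

    -- The reached positions are those of `A` outside `U`. All codes allowed there are placed by `y`
    -- at reached positions other than `i`, so these stay closed without `i`; they are not empty
    -- because some code is allowed at `i`.
    restrict : ∀ {U} → i ∉ U →
      (∀ {j m} → j ∈ A → j ∉ U → m ∈ U → m ∈ A → ¬ E j (lookup y m)) →
      (∀ {j} → j ∈ A → j ∉ U → ¬ E j (lookup y i)) → Repair A y (_≢ i)
    restrict {U} i∉U stuck noreturn = record
      { word = y ; part = A ─ U - i
      ; nonempty = let c , Eic = neighbour i ; l , l∈ , _ = next i∈A i∉U Eic in l , l∈
      ; sub = p─q⊆p A U ∘ p─q⊆p (A ─ U) _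
      ; closed = λ l∈ → next (p─q⊆p A U (p─q⊆p (A ─ U) _ l∈)) (x∈p─q⇒x∉q A U (p─q⊆p (A ─ U) _ l∈))
      ; occs = λ _ → refl
      ; kept = λ _ → inj₁ refl
      ; good = λ l∈ → inj₂ (x∈p-y⇒x≢y (A ─ U) l∈ , refl) }
      where
      next : ∀ {j c} → j ∈ A → j ∉ U → E j c → ∃ λ l → l ∈ A ─ U - i × lookup y l ≡ c
      next j∈A j∉U Ejc with A-closed j∈A Ejc
      ... | l , l∈A , refl = l , x∈p∧x≢y⇒x∈p-y
        (x∈p∧x∉q⇒x∈p─q l∈A λ l∈U → stuck j∈A j∉U l∈U l∈A Ejc)
        (λ { refl → noreturn j∈A j∉U Ejc }) , refl

    -- `U` stands for the positions not yet reached; it loses one at each step, hence the recursion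
    -- on its size.
    grow : ∀ U → Acc _<_ ∣ U ∣ → i ∉ U → (∀ {j} → j ∈ A → j ∉ U → Reached U j) →
      Repair A y (_≢ i)
    grow U (acc rec) i∉U reached with any? (λ j → any? λ m →
      j ∈? A ×-dec ¬? (j ∈? U) ×-dec m ∈? U ×-dec m ∈? A ×-dec E? j (lookup y m))
    ... | yes (j , m , j∈A , j∉U , m∈U , m∈A , Ejm) =
      grow (U - m) (rec (x∈p⇒∣p-x∣<∣p∣ m∈U)) (i∉U ∘ p─q⊆p U _) reached′
      where
      reached′ : ∀ {l} → l ∈ A → l ∉ U - m → Reached (U - m) l
      reached′ {l} l∈A l∉ with l ∈? U | l ≟ m
      ... | no l∉U | _ = reached-weaken (p─q⊆p U _) (reached l∈A l∉U)
      ... | yes _ | yes refl = reached-step j∈A j∉U m∈A m∈U Ejm (reached j∈A j∉U)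
      ... | yes l∈U | no l≢m = contradiction (x∈p∧x≢y⇒x∈p-y l∈U l≢m) l∉
    ... | no stuck with any? (λ j → j ∈? A ×-dec ¬? (j ∈? U) ×-dec E? j (lookup y i))
    ...   | yes (j , j∈A , j∉U , Eji) = augment j∈A Eji (reached j∈A j∉U)
    ...   | no noreturn = restrict i∉U
      (λ j∈A j∉U m∈U m∈A Ejm → stuck (_ , _ , j∈A , j∉U , m∈U , m∈A , Ejm))
      (λ j∈A j∉U Eji → noreturn (_ , j∈A , j∉U , Eji))

    repair-one : Repair A y (_≢ i)
    repair-one = grow (A - i) (<-wellFounded _) (λ i∈ → x∈p-y⇒x≢y A i∈ refl) start
      where
      start : ∀ {j} → j ∈ A → j ∉ A - i → Reached (A - i) j
      start {j} j∈A j∉ with j ≟ i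
      ... | no j≢i = contradiction (x∈p∧x≢y⇒x∈p-y j∈A j≢i) j∉
      ... | yes refl = y , rearrangement-refl , refl , moves , λ _ → refl
        where
        moves : ∀ l → l ≡ i ⊎ (l ≢ i × lookup y l ≡ lookup y l) ⊎ (l ∈ A × E l (lookup y l))
        moves l with l ≟ i
        ... | yes l≡i = inj₁ l≡i
        ... | no l≢i = inj₂ (inj₁ (l≢i , refl))

  open Repair

  repair-trans : ∀ {A y P} (r : Repair A y P) → Repair (part r) (word r) (λ _ → ⊥) →
    Repair A y (λ _ → ⊥)
  repair-trans {A} {y} r r′ = record
    { word = word r′ ; part = part r′ ; nonempty = nonempty r′ ; sub = sub r ∘ sub r′
    ; closed = closed r′ ; occs = λ a → trans (occs r′ a) (occs r a)
    ; kept = kept′ ; good = λ l∈ → inj₁ ([ id , (λ ()) ∘ proj₁ ]′ (good r′ l∈)) }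
    where
    kept′ : Kept A y (word r′)
    kept′ l with kept r′ l
    ... | inj₂ (l∈ , El) = inj₂ (sub r l∈ , El)
    ... | inj₁ e rewrite e = kept r l

  -- The list contains every position of `A` that still holds a forbidden code. Repairing its head
  -- creates no new one, so the tail serves for the smaller part.
  repair-list : ∀ (ps : List (Fin n)) {A y} → Nonempty A → Closed A y →
    (∀ {l} → l ∈ A → E l (lookup y l) ⊎ l ∈ₗ ps) → Repair A y (λ _ → ⊥)
  repair-list [] {A} {y} ne cl bad = record
    { word = y ; part = A ; nonempty = ne ; sub = id ; closed = cl ; occs = λ _ → refl
    ; kept = λ _ → inj₁ refl ; good = λ l∈ → inj₁ ([ id , (λ ()) ]′ (bad l∈)) }
  repair-list (i ∷ ps) {A} {y} ne cl bad with i ∈? A | E? i (lookup y i)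
  ... | no i∉A | _ = repair-list ps ne cl λ {l} l∈A → drop l∈A (bad l∈A)
    where
    drop : ∀ {l} → l ∈ A → E l (lookup y l) ⊎ l ∈ₗ i ∷ ps → E l (lookup y l) ⊎ l ∈ₗ ps
    drop l∈A (inj₁ El) = inj₁ El
    drop l∈A (inj₂ (here refl)) = contradiction l∈A i∉A
    drop l∈A (inj₂ (there l∈)) = inj₂ l∈
  ... | yes _ | yes Ei = repair-list ps ne cl λ {l} l∈A → drop (bad l∈A)
    where
    drop : ∀ {l} → E l (lookup y l) ⊎ l ∈ₗ i ∷ ps → E l (lookup y l) ⊎ l ∈ₗ ps
    drop (inj₁ El) = inj₁ El
    drop (inj₂ (here refl)) = inj₁ Ei
    drop (inj₂ (there l∈)) = inj₂ l∈
  ... | yes i∈A | no ¬Ei = repair-trans r (repair-list ps (nonempty r) (closed r) bad′)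
    where
    r : Repair A y (_≢ i)
    r = Search.repair-one cl i∈A ¬Ei
    bad′ : ∀ {l} → l ∈ part r → E l (lookup (word r) l) ⊎ l ∈ₗ ps
    bad′ {l} l∈ with good r l∈
    ... | inj₁ El = inj₁ El
    ... | inj₂ (l≢i , e) rewrite e with bad (sub r l∈)
    ...   | inj₁ El = inj₁ El
    ...   | inj₂ (here l≡i) = contradiction l≡i l≢i
    ...   | inj₂ (there l∈ps) = inj₂ l∈ps

  repair : ∀ {A y} → Nonempty A → Closed A y → Repair A y (λ _ → ⊥)
  repair ne cl = repair-list (allFin n) ne cl λ {l} _ → inj₂ (∈-allFin l)

-- The adversary and the lower bound.

avoid : ∀ {k n} (e : Fin n → Fin k) → (∀ {i j} → e i ≡ e j → i ≡ j) →
  (cs : List (Fin k)) → length cs < n → ∃ λ i → e i ∉ₗ cs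
avoid e e-inj cs cs<n with any? (λ i → ¬? (e i ∈ₗ? cs))
  where open DecMembership _≟_ renaming (_∈?_ to _∈ₗ?_)
... | yes found = found
... | no none = let i , j , i<j , same = pigeonhole cs<n (Any.index ∘ covered) in
  contradiction (e-inj (trans (lookup-index (covered i))
    (trans (cong (List.lookup cs) same) (sym (lookup-index (covered j)))))) (<⇒≢ i<j)
  where
  open DecMembership _≟_ renaming (_∈?_ to _∈ₗ?_)
  covered : ∀ i → e i ∈ₗ cs
  covered i = decidable-stable (e i ∈ₗ? cs) (λ ∉ → none (i , ∉))

module Survival {k n} (w : Word k n) (w-inj : ∀ {i j} → lookup w i ≡ lookup w j → i ≡ j) where

  -- A code of `w` is excluded at a position only by having been guessed there; other marks are not
  -- consulted.
  Possible : List (Word k n) → Fin n → Fin k → Set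
  Possible xs i c = (∃ λ l → lookup w l ≡ c) × All (λ x → lookup x i ≢ c) xs

  possible? : ∀ xs i c → Dec (Possible xs i c)
  possible? xs i c = any? (λ l → lookup w l ≟ c) ×-dec All.all? (λ x → ¬? (lookup x i ≟ c)) xs

  -- Each guess excludes at most one code at `i`, and `w` has `n` distinct codes.
  possible-neighbour : ∀ xs → length xs < n → ∀ i → ∃ (Possible xs i)
  possible-neighbour xs xs<n i =
    let l , l∉ = avoid (lookup w) w-inj (List.map (λ x → lookup x i) xs)
                   (subst (_< n) (sym (Listₚ.length-map _ xs)) xs<n)
    in lookup w l , (l , refl) ,
       All.tabulate λ x∈ e → l∉ (subst (_∈ₗ _) e (∈-map⁺ (λ x → lookup x i) x∈))

  older : ∀ {x xs i c} → Possible (x ∷ xs) i c → Possible xs i c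
  older (c∈w , _ ∷ ps) = c∈w , ps

  unmatched : ∀ {x xs i c} → Possible (x ∷ xs) i c → lookup x i ≢ c
  unmatched (_ , x≢c ∷ _) = x≢c

  module Round (x : Word k n) (xs : List (Word k n)) (lt : length (x ∷ xs) < n) where
    open Matching (Possible (x ∷ xs)) (possible? (x ∷ xs)) (possible-neighbour (x ∷ xs) lt) public

    module After {A y} (R : Repair A y (λ _ → ⊥)) (z : Word k n)
      (z-possible : ∀ {i} → i ∈ Repair.part R → Possible (x ∷ xs) i (lookup z i))
      (z-outside : ∀ {i} → i ∉ Repair.part R → lookup z i ≡ lookup (Repair.word R) i) where
      open Repair R

      good′ : ∀ {i} → i ∈ part → Possible (x ∷ xs) i (lookup word i)
      good′ i∈ = [ id , (λ ()) ∘ proj₁ ]′ (good i∈)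

      possible : (∀ {i} → i ∈ A → Possible xs i (lookup y i)) →
        ∀ {i} → i ∈ A → Possible xs i (lookup z i)
      possible poss {i} i∈A with i ∈? part
      ... | yes i∈ = older (z-possible i∈)
      ... | no i∉ with kept i
      ...   | inj₁ e = subst (Possible xs i) (sym (trans (z-outside i∉) e)) (poss i∈A)
      ...   | inj₂ (_ , p) = subst (Possible xs i) (sym (z-outside i∉)) (older p)

      unchanged : ∀ {i} → i ∉ A → lookup z i ≡ lookup y i
      unchanged {i} i∉A with kept i
      ... | inj₁ e = trans (z-outside (i∉A ∘ sub)) e
      ... | inj₂ (i∈A , _) = contradiction i∈A i∉A

      -- On `part` neither word is green against `x`; elsewhere the two coincide.
      same-greens : SameGreens x word z
      same-greens i with i ∈? part
      ... | yes i∈ = (λ e → contradiction e (unmatched (good′ i∈)))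
                   , (λ e → contradiction e (unmatched (z-possible i∈)))
      ... | no i∉ = (λ e → trans e (sym (z-outside i∉))) , (λ e → trans e (z-outside i∉))

      not-guessed : x ≢ z
      not-guessed x≡z = let i , i∈ = nonempty in
        unmatched (z-possible i∈) (cong (λ v → lookup v i) x≡z)

  -- The conclusion says more than that `z` is missed: `z` differs from `y` only on `A` and avoids
  -- `xs` there, which makes the feedback of earlier rounds valid for `z`.
  survive : ∀ (s : Strategy k n) m xs h A y → length xs + m < n → Nonempty A →
    (∀ a → occ a y ≡ occ a w) → (∀ {i} → i ∈ A → Possible xs i (lookup y i)) →
    (∀ {i c} → i ∈ A → Possible xs i c → ∃ λ l → l ∈ A × lookup y l ≡ c) →
    ∃ λ z → (∀ a → occ a z ≡ occ a w) × (∀ {i} → i ∈ A → Possible xs i (lookup z i)) ×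
      (∀ {i} → i ∉ A → lookup z i ≡ lookup y i) × ¬ Any (_≡ z) (play s z m h)
  survive s zero xs h _ y _ _ occs poss _ = y , occs , poss , (λ _ → refl) , λ ()
  survive s (suc m) xs h A y lt ne occs poss cl =
    let x = s h
        lt′ = subst (_< n) (ℕₚ.+-suc (length xs) m) lt
        open Round x xs (ℕₚ.m+n≤o⇒m≤o _ lt′)
        R = repair {A} {y} ne (λ i∈A p → cl i∈A (older p))
        y₁ = Repair.word R
        y₁-occs = λ a → trans (Repair.occs R a) (occs a)
        z , z-occs , z-possible , z-outside , missed =
          -- The round is answered as if `y₁` were the secret; `same-feedback` shows that `z` gives
          -- the same answer.
          survive s m (x ∷ xs) (h ++ [ (x , feedback x y₁) ]) (Repair.part R) y₁ lt′
            (Repair.nonempty R) y₁-occs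
            (λ i∈ → [ id , (λ ()) ∘ proj₁ ]′ (Repair.good R i∈)) (Repair.closed R)
        open After R z z-possible z-outside
        same-feedback = feedback-cong x y₁ z same-greens (λ a → trans (y₁-occs a) (sym (z-occs a)))
    in z , z-occs , possible poss , unchanged ,
       λ { (here x≡z) → not-guessed x≡z
         ; (there found) → missed (subst (λ f → Any (_≡ z) (play s z m (h ++ [ (x , f) ])))
                                         (sym same-feedback) found) }

record Distinct {k} (n : ℕ) (used : List (Fin k)) : Set where
  field
    word      : Word k n
    injective : ∀ {i j} → lookup word i ≡ lookup word j → i ≡ j
    unused    : ∀ i → lookup word i ∉ₗ used

distinct : ∀ {k} n (used : List (Fin k)) → length used + n ≤ k → Distinct n used
distinct zero used _ = record { word = [] ; injective = λ { {()} } ; unused = λ () }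
distinct {k} (suc n) used le = record
  { word = c ∷ word
  ; injective = λ { {zero} {zero} _ → refl
                  ; {zero} {suc j} e → contradiction (here (sym e)) (unused j)
                  ; {suc i} {zero} e → contradiction (here e) (unused i)
                  ; {suc i} {suc j} e → cong suc (injective e) }
  ; unused = λ { zero → c∉ ; (suc i) → unused i ∘ there } }
  where
  le′ : length used + n < k
  le′ = subst (_≤ k) (ℕₚ.+-suc (length used) n) le
  new = avoid id id used (ℕₚ.m+n≤o⇒m≤o _ le′)
  c = proj₁ new
  c∉ = proj₂ new
  open Distinct (distinct n (c ∷ used) le′)

evade : ∀ {k n} (s : Strategy k (suc n)) q h used → length used + (q * suc n + suc n) ≤ k →
  ∃ λ z → (∀ i → lookup z i ∉ₗ used) × ¬ Any (_≡ z) (play s z (q + n) h)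
evade {n = n} s zero h used le = z , fresh , missed
  where
  open Distinct (distinct (suc n) used le)
  -- The list of excluding guesses starts empty: the codes of the all-B rounds are in `used`, which
  -- `word` avoids.
  found = Survival.survive word injective s n [] h ⊤ word ℕₚ.≤-refl (zero , ∈⊤) (λ _ → refl)
    (λ {i} _ → (i , refl) , []) (λ { _ ((l , e) , _) → l , ∈⊤ , e })
  z = proj₁ found
  missed = proj₂ (proj₂ (proj₂ (proj₂ found)))
  fresh : ∀ i → lookup z i ∉ₗ used
  fresh i with positive-occ word (subst (0 <_) (proj₁ (proj₂ found) (lookup z i)) (occ-positive z i))
  ... | l , e rewrite sym e = unused l
evade {k} {n} s (suc q) h used le = z , (λ i → fresh i ∘ ∈-++⁺ʳ (toList x)) , missed′
  where
  x = s h
  le′ : length (toList x ++ used) + (q * suc n + suc n) ≤ k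
  le′ = subst (_≤ k) (begin
    length used + (suc n + q * suc n + suc n)   ≡⟨ cong (length used +_) (ℕₚ.+-assoc (suc n) (q * suc n) (suc n)) ⟩
    length used + (suc n + (q * suc n + suc n)) ≡⟨ ℕₚ.+-assoc (length used) (suc n) _ ⟨
    length used + suc n + (q * suc n + suc n)   ≡⟨ cong (_+ (q * suc n + suc n)) (ℕₚ.+-comm (length used) (suc n)) ⟩
    suc n + length used + (q * suc n + suc n)   ≡⟨ cong (λ l → l + length used + (q * suc n + suc n)) (length-toList x) ⟨
    length (toList x) + length used + (q * suc n + suc n) ≡⟨ cong (_+ (q * suc n + suc n)) (Listₚ.length-++ (toList x)) ⟨
    length (toList x ++ used) + (q * suc n + suc n) ∎) le
    where open ≡-Reasoning
  rec = evade s q (h ++ [ (x , replicate (suc n) B) ]) (toList x ++ used) le′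
  z = proj₁ rec
  fresh = proj₁ (proj₂ rec)
  disjoint : ∀ i j → lookup x i ≢ lookup z j
  disjoint i j e = fresh j (∈-++⁺ˡ (subst (_∈ₗ toList x) e (∈-toList⁺ (∈-lookup i x))))
  missed′ : ¬ Any (_≡ z) (play s z (suc q + n) h)
  missed′ (here x≡z) = disjoint zero zero (cong (λ v → lookup v zero) x≡z)
  missed′ (there found) = proj₂ (proj₂ rec)
    (subst (λ f → Any (_≡ z) (play s z (q + n) (h ++ [ (x , f) ]))) (feedback-allB x z disjoint) found)

play-extend : ∀ {k n} {P : Word k n → Set} (s : Strategy k n) y {m m′} h → m ≤ m′ →
  Any P (play s y m h) → Any P (play s y m′ h)
play-extend s y h (s≤s m≤m′) (here p) = here p
play-extend s y h (s≤s m≤m′) (there p) = there (play-extend s y _ m≤m′ p)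

lower-bound : ∀ {k n} c (s : Strategy k (suc n)) m → suc c * suc n ≤ k → WinsWithin s m → c + suc n ≤ m
lower-bound {k} {n} c s m cn≤k wins = ℕₚ.≮⇒≥ λ m< →
  -- After `c` all-B rounds `suc n` codes are left, so `c + n` guesses miss some answer.
  let z , _ , missed = evade s c [] [] (subst (_≤ k) (ℕₚ.+-comm (suc n) (c * suc n)) cn≤k)
  in missed (play-extend s z [] (ℕₚ.≤-pred (subst (suc m ≤_) (ℕₚ.+-suc c n) m<)) (wins z))

-- Strategies that guess from a consistent answer.

_≟ᶜ_ : (a b : Colour) → Dec (a ≡ b)
G ≟ᶜ G = yes refl
G ≟ᶜ Y = no λ ()
G ≟ᶜ B = no λ ()
Y ≟ᶜ G = no λ ()
Y ≟ᶜ Y = yes refl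
Y ≟ᶜ B = no λ ()
B ≟ᶜ G = no λ ()
B ≟ᶜ Y = no λ ()
B ≟ᶜ B = yes refl

anyWord? : ∀ {k} n {P : Word k n → Set} → (∀ y → Dec (P y)) → Dec (∃ P)
anyWord? zero P? = map′ ([] ,_) (λ { ([] , p) → p }) (P? [])
anyWord? (suc n) P? = map′ (λ { (a , y , p) → a ∷ y , p }) (λ { (a ∷ y , p) → a , y , p })
  (any? λ a → anyWord? n λ y → P? (a ∷ y))

-- Let q t y be the guess of round t when the answer is y.  If it depends on y only
-- through the feedback of the previous rounds, the codebreaker can play q t y₀ with
-- any y₀ consistent with the history.
module Adaptive {k n} (d : Fin k) (q : ℕ → Word k n → Word k n) (N : ℕ)
  (determined : ∀ {t} → t < suc N → ∀ y z →
    (∀ {u} → u < t → feedback (q u y) z ≡ feedback (q u y) y) → q t z ≡ q t y) where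

  Consistent : History k n → Word k n → Set
  Consistent h y = All (λ g → feedback (proj₁ g) y ≡ proj₂ g) h

  consistent? : ∀ h → Dec (∃ (Consistent h))
  consistent? h = anyWord? n λ y →
    All.all? (λ g → Vecₚ.≡-dec _≟ᶜ_ (feedback (proj₁ g) y) (proj₂ g)) h

  candidate : History k n → Word k n
  candidate h with consistent? h
  ... | yes (y , _) = y
  -- A default for histories that no answer produces.
  ... | no _ = replicate n d

  candidate-consistent : ∀ {h y} → Consistent h y → Consistent h (candidate h)
  candidate-consistent {h} {y} c with consistent? h
  ... | yes (_ , c′) = c′
  ... | no none = contradiction (y , c) none

  strategy : Strategy k n
  strategy h = q (length h) (candidate h)

  history : Word k n → ℕ → History k n
  history y zero = []
  history y (suc t) = history y t ++ [ (q t y , feedback (q t y) y) ]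

  length-history : ∀ y t → length (history y t) ≡ t
  length-history y zero = refl
  length-history y (suc t) = trans (Listₚ.length-++ (history y t))
    (trans (ℕₚ.+-comm _ 1) (cong suc (length-history y t)))

  history-consistent : ∀ y t → Consistent (history y t) y
  history-consistent y zero = []
  history-consistent y (suc t) = Allₚ.++⁺ (history-consistent y t) (refl ∷ [])

  consistent-feedback : ∀ y t {z} → Consistent (history y t) z →
    ∀ {u} → u < t → feedback (q u y) z ≡ feedback (q u y) y
  consistent-feedback y (suc t) c u<1+t with ℕₚ.m<1+n⇒m<n∨m≡n u<1+t
  ... | inj₁ u<t = consistent-feedback y t (Allₚ.++⁻ˡ (history y t) c) u<t
  ... | inj₂ refl = All.head (Allₚ.++⁻ʳ (history y t) c)

  -- The candidate may differ from `y`, but it fits all earlier feedback, so `determined` gives the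
  -- same guess.
  strategy-history : ∀ y {t} → t < suc N → strategy (history y t) ≡ q t y
  strategy-history y {t} t<N rewrite length-history y t =
    determined t<N y _ (consistent-feedback y t (candidate-consistent (history-consistent y t)))

  play-history : ∀ y m {t} → t + m ≡ N → q N y ≡ y →
    Any (_≡ y) (play strategy y (suc m) (history y t))
  play-history y m {t} t+m≡N qN with strategy-history y {t} (s≤s (subst (t ≤_) t+m≡N (ℕₚ.m≤m+n t m)))
  play-history y zero {t} t+m≡N qN | e =
    here (trans e (subst (λ u → q u y ≡ y) (trans (sym t+m≡N) (ℕₚ.+-identityʳ t)) qN))
  play-history y (suc m) {t} t+m≡N qN | e rewrite e =
    there (play-history y m (trans (sym (ℕₚ.+-suc t m)) t+m≡N) qN)

  wins : (∀ y → q N y ≡ y) → WinsWithin strategy (suc N)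
  wins qN y = play-history y N refl (qN y)

-- The set of codes of an answer.

unique-lookup : ∀ {k} {L : List (Fin k)} → Unique L → ∀ {i j} →
  List.lookup L i ≡ List.lookup L j → i ≡ j
unique-lookup (_ ∷ _) {zero} {zero} _ = refl
unique-lookup {L = _ ∷ L} (a∉ ∷ _) {zero} {suc j} e = contradiction e (All.lookup a∉ (Listₘ.∈-lookup j))
unique-lookup {L = _ ∷ L} (a∉ ∷ _) {suc i} {zero} e = contradiction (sym e) (All.lookup a∉ (Listₘ.∈-lookup i))
unique-lookup (_ ∷ u) {suc i} {suc j} e = cong suc (unique-lookup u e)

unique-length : ∀ {k n} {L : List (Fin k)} → Unique L → (f : Fin n → Fin k) →
  (∀ {a} → a ∈ₗ L → ∃ λ i → f i ≡ a) → length L ≤ n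
unique-length {L = L} uniq f covers = ℕₚ.≮⇒≥ λ n<L →
  let i , j , i<j , same = pigeonhole n<L (proj₁ ∘ preimage)
  in <⇒≢ i<j (unique-lookup uniq (trans (sym (proj₂ (preimage i)))
       (trans (cong f same) (proj₂ (preimage j)))))
  where
  preimage : ∀ m → ∃ λ i → f i ≡ List.lookup L m
  preimage m = covers (Listₘ.∈-lookup m)

-- If two positions held the same code, deleting one would leave too few positions to cover the
-- distinct codes of `L`.
full-injective : ∀ {k n} {L : List (Fin k)} → Unique L → length L ≡ n → (y : Word k n) →
  (∀ {a} → a ∈ₗ L → ∃ λ i → lookup y i ≡ a) → ∀ {i j} → lookup y i ≡ lookup y j → i ≡ j
full-injective {n = suc n} {L} uniq len y covers {i} {j} e with i ≟ j
... | yes i≡j = i≡j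
... | no i≢j = contradiction (unique-length uniq (lookup y ∘ punchIn j) covers′)
                 (ℕₚ.<⇒≱ (subst (n <_) (sym len) ℕₚ.≤-refl))
  where
  covers′ : ∀ {a} → a ∈ₗ L → ∃ λ m → lookup y (punchIn j m) ≡ a
  covers′ a∈L with covers a∈L
  ... | m , ym with j ≟ m
  ...   | no j≢m = punchOut j≢m , trans (cong (lookup y) (punchIn-punchOut j≢m)) ym
  ...   | yes refl = punchOut (i≢j ∘ sym) , trans (cong (lookup y) (punchIn-punchOut (i≢j ∘ sym))) (trans e ym)

occurs? : ∀ {k n} (y : Word k n) a → Dec (∃ λ i → lookup y i ≡ a)
occurs? y a = any? λ i → lookup y i ≟ a

-- Filtering the fixed list of all codes is canonical: answers with the same set of codes get equal
-- lists.
codes : ∀ {k n} → Word k n → List (Fin k)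
codes {k} y = List.filter (occurs? y) (allFin k)

codes-unique : ∀ {k n} (y : Word k n) → Unique (codes y)
codes-unique {k} y = Uniqueₚ.filter⁺ (occurs? y) (Uniqueₚ.allFin⁺ k)

codes⁻ : ∀ {k n} (y : Word k n) {a} → a ∈ₗ codes y → ∃ λ i → lookup y i ≡ a
codes⁻ {k} y a∈ = proj₂ (∈-filter⁻ (occurs? y) {xs = allFin k} a∈)

codes⁺ : ∀ {k n} (y : Word k n) i → lookup y i ∈ₗ codes y
codes⁺ y i = ∈-filter⁺ (occurs? y) (∈-allFin (lookup y i)) (i , refl)

codes-cong : ∀ {k n} (y z : Word k n) →
  (∀ {a} → (∃ λ i → lookup y i ≡ a) → ∃ λ i → lookup z i ≡ a) →
  (∀ {a} → (∃ λ i → lookup z i ≡ a) → ∃ λ i → lookup y i ≡ a) → codes y ≡ codes z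
codes-cong {k} y z y⊆z z⊆y = Listₚ.filter-≐ (occurs? y) (occurs? z) (y⊆z , z⊆y) (allFin k)

-- Locating codes by tests.

module Breaking {k n} (y z : Word k n) where

  Tested : Fin k → Fin n → Set
  Tested a i = (lookup y i ≡ a → lookup z i ≡ a) × (lookup z i ≡ a → lookup y i ≡ a)

  tested : ∀ x {a} i → feedback x z ≡ feedback x y → lookup x i ≡ a → Tested a i
  tested x i eq refl = (λ e → sym (feedback-match x y z (sym eq) i (sym e)))
                     , (λ e → sym (feedback-match x z y eq i (sym e)))

  -- Where either answer has a code other than `e`, the tests force agreement; elsewhere both have
  -- `e`.
  all-but-one-code : ∀ e → (∀ i → lookup y i ≡ e ⊎ (∀ l → Tested (lookup y i) l)) →
    (∀ i → lookup z i ≡ e ⊎ (∀ l → Tested (lookup z i) l)) → z ≡ y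
  all-but-one-code e y-tested z-tested = trans (sym (Vecₚ.tabulate∘lookup z))
    (trans (Vecₚ.tabulate-cong same) (Vecₚ.tabulate∘lookup y))
    where
    same : ∀ i → lookup z i ≡ lookup y i
    same i with y-tested i | z-tested i
    ... | inj₂ t | _ = proj₁ (t i) refl
    ... | inj₁ _ | inj₂ t = sym (proj₂ (t i) refl)
    ... | inj₁ p | inj₁ p′ = trans p′ (sym p)

-- If a occurs exactly once, testing it at all positions but one locates it.
all-but-one-position : ∀ {k n} (y z : Word k n) → (∀ {i j} → lookup y i ≡ lookup y j → i ≡ j) →
  ∀ {a} → (∃ λ l → lookup z l ≡ a) → ∀ e → (∀ {i} → i ≢ e → Breaking.Tested y z a i) →
  ∀ i → lookup y i ≡ a → lookup z i ≡ a
all-but-one-position y z y-inj (l , zl) e tested i yi with i ≟ e | l ≟ e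
... | no i≢e | _ = proj₁ (tested i≢e) yi
... | yes refl | yes refl = zl
... | yes refl | no l≢e = contradiction (y-inj (trans (proj₂ (tested l≢e) zl) (sym yi))) l≢e

-- The default keeps the test guesses defined in rounds beyond the end of a short list.
nth : ∀ {a} {A : Set a} → A → List A → ℕ → A
nth d [] _ = d
nth d (a ∷ as) zero = a
nth d (a ∷ as) (suc j) = nth d as j

∈-nth : ∀ {a} {A : Set a} (d : A) {as x} → x ∈ₗ as → ∃ λ j → j < length as × nth d as j ≡ x
∈-nth d (here refl) = zero , s≤s z≤n , refl
∈-nth d (there x∈) = let j , lt , e = ∈-nth d x∈ in suc j , s≤s lt , e

-- The codebreaker's guesses and the upper bound.

module Codebreaker {k} (c p : ℕ) (d : Fin k) (k< : k ≤ suc c * suc (suc p)) where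

  n : ℕ
  n = suc (suc p)

  -- Indices from `k` on are padded with `d`, as the `suc c` probes may have more than `k` entries.
  code : ℕ → Fin k
  code m with m ℕₚ.<? k
  ... | yes m<k = fromℕ< m<k
  ... | no _ = d

  code-toℕ : ∀ a → code (toℕ a) ≡ a
  code-toℕ a with toℕ a ℕₚ.<? k
  ... | yes a<k = fromℕ<-toℕ a a<k
  ... | no a≮k = contradiction (toℕ<n a) a≮k

  probe : ℕ → Word k n
  probe t = tabulate λ i → code (toℕ i + t * n)

  slot : Fin k → Fin n
  slot a = toℕ a mod n

  round : Fin k → ℕ
  round a = toℕ a / n

  round< : ∀ a → round a < suc c
  round< a = m<n*o⇒m/o<n (ℕₚ.<-≤-trans (toℕ<n a) k<)

  probe-slot : ∀ a → lookup (probe (round a)) (slot a) ≡ a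
  probe-slot a = begin
    lookup (probe (round a)) (slot a)   ≡⟨ Vecₚ.lookup∘tabulate (λ i → code (toℕ i + round a * n)) (slot a) ⟩
    code (toℕ (slot a) + round a * n)   ≡⟨ cong (λ m → code (m + round a * n)) (toℕ-fromℕ< (m%n<n (toℕ a) n)) ⟩
    code (toℕ a % n + toℕ a / n * n)    ≡⟨ cong code (m≡m%n+[m/n]*n (toℕ a) n) ⟨
    code (toℕ a)                        ≡⟨ code-toℕ a ⟩
    a ∎
    where open ≡-Reasoning

  SameProbes : Word k n → Word k n → Set
  SameProbes y z = ∀ {t} → t < suc c → feedback (probe t) z ≡ feedback (probe t) y

  probes-codes : ∀ y z → SameProbes y z → codes z ≡ codes y
  probes-codes y z same = codes-cong z y
    (λ { {a} (i , e) → carry a z y (same (round< a)) i e })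
    (λ { {a} (i , e) → carry a y z (sym (same (round< a))) i e })
    where
    carry : ∀ a v w → feedback (probe (round a)) v ≡ feedback (probe (round a)) w → ∀ i →
      lookup v i ≡ a → ∃ λ l → lookup w l ≡ a
    carry a v w eq i refl = feedback-occurs (probe (round a)) v w eq (slot a) i (probe-slot a)

  -- A probe already tests `u` at `slot u`. Of the other `p + 1` positions, the first `p` are used
  -- one per test round; the last, `unspared u`, is left to exclusion.
  spare : Fin k → Fin p → Fin n
  spare u j = punchIn (slot u) (inject₁ j)

  unspared : Fin k → Fin n
  unspared u = punchIn (slot u) (fromℕ p)

  -- The head `u` gets no round of its own: with fewer than `n` codes it is the one left over, and
  -- with `n` codes it is tested at the spare positions.
  test : List (Fin k) → Fin p → Word k n
  test [] j = replicate n d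
  test (u ∷ as) j with length (u ∷ as) ℕₚ.≟ n
  ... | yes _ = replicate n (nth d as (toℕ j)) [ spare u j ]≔ u
  ... | no _ = replicate n (nth d as (toℕ j))

  determine : ∀ y z L → codes y ≡ L → codes z ≡ L → SameProbes y z →
    (∀ j → feedback (test L j) z ≡ feedback (test L j) y) → z ≡ y
  determine y z [] Ly Lz same same-tests = contradiction (subst (lookup y zero ∈ₗ_) Ly (codes⁺ y zero)) λ ()
  determine y z (u ∷ as) Ly Lz same same-tests with length (u ∷ as) ℕₚ.≟ n
  ... | no len≢n = all-but-one-code u (λ i → located (subst (lookup y i ∈ₗ_) Ly (codes⁺ y i)))
                                      (λ i → located (subst (lookup z i ∈ₗ_) Lz (codes⁺ z i)))
    where
    open Breaking y z
    -- With fewer than `n` codes in all, the `p` rounds reach every code of `as`.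
    as≤p : length as ≤ p
    as≤p = ℕₚ.≤-pred (ℕₚ.≤-pred (ℕₚ.≤∧≢⇒< (subst (λ L → length L ≤ n) Ly
      (unique-length (codes-unique y) (lookup y) (codes⁻ y))) len≢n))
    located : ∀ {a} → a ∈ₗ u ∷ as → a ≡ u ⊎ (∀ l → Tested a l)
    located (here a≡u) = inj₁ a≡u
    located (there a∈) with ∈-nth d a∈
    ... | j , j<as , refl = inj₂ λ l → tested (replicate n (nth d as (toℕ j′))) l (same-tests j′)
        (trans (Vecₚ.lookup-replicate l _) (cong (nth d as) (toℕ-fromℕ< j<p)))
      where
      j<p = ℕₚ.<-≤-trans j<as as≤p
      j′ = fromℕ< j<p
  -- Here `as` has `p + 1` codes; its last one gets no round and is the exception.
  ... | yes len≡n = all-but-one-code (nth d as p) (λ i → located (subst (lookup y i ∈ₗ_) Ly (codes⁺ y i)))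
                                                  (λ i → located (subst (lookup z i ∈ₗ_) Lz (codes⁺ z i)))
    where
    open Breaking y z
    covers : ∀ w → codes w ≡ u ∷ as → ∀ {a} → a ∈ₗ u ∷ as → ∃ λ i → lookup w i ≡ a
    covers w eq a∈ = codes⁻ w (subst (_ ∈ₗ_) (sym eq) a∈)
    uniq : Unique (u ∷ as)
    uniq = subst Unique Ly (codes-unique y)
    settled : ∀ {a} → a ∈ₗ u ∷ as → ∀ e → (∀ {i} → i ≢ e → Tested a i) → ∀ l → Tested a l
    settled a∈ e t l =
      all-but-one-position y z (full-injective uniq len≡n y (covers y Ly)) (covers z Lz a∈) e t l ,
      all-but-one-position z y (full-injective uniq len≡n z (covers z Lz)) (covers y Ly a∈) e (flip ∘ t) l
      where
      flip : ∀ {a i} → Tested a i → Breaking.Tested z y a i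
      flip (f , g) = g , f
    u-tested : ∀ {i} → i ≢ unspared u → Tested u i
    u-tested {i} i≢ with slot u ≟ i
    ... | yes refl = tested (probe (round u)) (slot u) (same (round< u)) (probe-slot u)
    ... | no slot≢i with punchOut slot≢i | punchIn-punchOut slot≢i
    ...   | m | pin with view m
    ...     | ‵fromℕ = contradiction (sym pin) i≢
    ...     | ‵inject₁ j =
      let x = replicate n (nth d as (toℕ j)) in
      tested (x [ spare u j ]≔ u) i (same-tests j)
        (subst (λ v → lookup (x [ spare u j ]≔ u) v ≡ u) pin (lookup∘update (spare u j) x u))
    located : ∀ {a} → a ∈ₗ u ∷ as → a ≡ nth d as p ⊎ (∀ l → Tested a l)
    located (here refl) = inj₂ (settled (here refl) (unspared u) u-tested)
    located (there a∈) with ∈-nth d a∈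
    ... | j , j<as , refl with ℕₚ.m<1+n⇒m<n∨m≡n {j} {p} (subst (j <_) (ℕₚ.suc-injective len≡n) j<as)
    ...   | inj₂ refl = inj₁ refl
    ...   | inj₁ j<p = inj₂ (settled (there a∈) (spare u j′) λ {i} i≢ →
            tested (x [ spare u j′ ]≔ u) i (same-tests j′)
              (trans (lookup∘update′ i≢ x u)
                (trans (Vecₚ.lookup-replicate i _) (cong (nth d as) (toℕ-fromℕ< j<p)))))
      where
      j′ = fromℕ< j<p
      x = replicate n (nth d as (toℕ j′))

  guess : ℕ → Word k n → Word k n
  guess t y with t ℕₚ.<? suc c
  ... | yes _ = probe t
  ... | no _ with (t ∸ suc c) ℕₚ.<? p
  ...   | yes j<p = test (codes y) (fromℕ< j<p)
  ...   | no _ = y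

  guess-probe : ∀ {t} → t < suc c → ∀ y → guess t y ≡ probe t
  guess-probe {t} t<c y with t ℕₚ.<? suc c
  ... | yes _ = refl
  ... | no t≮c = contradiction t<c t≮c

  guess-test : ∀ j y → guess (suc c + toℕ j) y ≡ test (codes y) j
  guess-test j y with suc c + toℕ j ℕₚ.<? suc c
  ... | yes lt = contradiction lt (ℕₚ.m+n≮m (suc c) (toℕ j))
  ... | no _ with (c + toℕ j ∸ c) ℕₚ.<? p
  ...   | yes j<p = cong (test (codes y)) (toℕ-injective (trans (toℕ-fromℕ< j<p) (ℕₚ.m+n∸m≡n c (toℕ j))))
  ...   | no j≮p = contradiction (subst (_< p) (sym (ℕₚ.m+n∸m≡n c (toℕ j))) (toℕ<n j)) j≮p

  guess-last : ∀ y → guess (suc c + p) y ≡ y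
  guess-last y with suc c + p ℕₚ.<? suc c
  ... | yes lt = contradiction lt (ℕₚ.m+n≮m (suc c) p)
  ... | no _ with (c + p ∸ c) ℕₚ.<? p
  ...   | yes lt = contradiction (subst (_< p) (ℕₚ.m+n∸m≡n c p) lt) (ℕₚ.<-irrefl refl)
  ...   | no _ = refl

  data Phase : ℕ → Set where
    probing : ∀ {t} → t < suc c → Phase t
    testing : (j : Fin p) → Phase (suc c + toℕ j)
    last    : Phase (suc c + p)

  phase : ∀ {t} → t < suc (suc c + p) → Phase t
  phase {t} t< with t ℕₚ.<? suc c
  ... | yes t<c = probing t<c
  ... | no t≮c with ℕₚ.m≤n⇒∃[o]m+o≡n (ℕₚ.≮⇒≥ t≮c)
  ...   | j , refl with ℕₚ.m<1+n⇒m<n∨m≡n {j} {p} (ℕₚ.+-cancelˡ-< (suc c) j (suc p) (subst (suc c + j <_) (sym (ℕₚ.+-suc (suc c) p)) t<))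
  ...     | inj₁ j<p = subst (λ m → Phase (suc c + m)) (toℕ-fromℕ< j<p) (testing (fromℕ< j<p))
  ...     | inj₂ refl = last

  -- Probes are fixed, tests depend on `y` only through `codes y`, which the probes reveal, and the
  -- last guess is settled by `determine`.
  determined : ∀ {t} → t < suc (suc c + p) → ∀ y z →
    (∀ {u} → u < t → feedback (guess u y) z ≡ feedback (guess u y) y) → guess t z ≡ guess t y
  determined t< y z same = go (phase t<) same
    where
    same-probes : ∀ {t} → suc c ≤ t →
      (∀ {u} → u < t → feedback (guess u y) z ≡ feedback (guess u y) y) → SameProbes y z
    same-probes c<t same u<c = subst (λ x → feedback x z ≡ feedback x y) (guess-probe u<c y)
      (same (ℕₚ.<-≤-trans u<c c<t))
    go : ∀ {t} → Phase t →
      (∀ {u} → u < t → feedback (guess u y) z ≡ feedback (guess u y) y) → guess t z ≡ guess t y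
    go (probing t<c) same = trans (guess-probe t<c z) (sym (guess-probe t<c y))
    go (testing j) same = trans (guess-test j z)
      (trans (cong (λ L → test L j) (probes-codes y z (same-probes (ℕₚ.m≤m+n (suc c) _) same)))
             (sym (guess-test j y)))
    go last same = trans (guess-last z)
      (trans (determine y z (codes y) refl (probes-codes y z probes) probes tests) (sym (guess-last y)))
      where
      probes : SameProbes y z
      probes = same-probes (ℕₚ.m≤m+n (suc c) _) same
      tests : ∀ j → feedback (test (codes y) j) z ≡ feedback (test (codes y) j) y
      tests j = subst (λ x → feedback x z ≡ feedback x y) (guess-test j y)
        (same (ℕₚ.+-monoʳ-< (suc c) (toℕ<n j)))

  open Adaptive d guess (suc c + p) determined public using (strategy; wins)

upper-bound : ∀ {k} c n → Fin k → 2 ≤ n → k ≤ suc c * n → Σ (Strategy k n) λ s → WinsWithin s (c + n)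
upper-bound c (suc (suc p)) d (s≤s (s≤s z≤n)) k≤ =
  -- The `c + 1` probes, `p` tests and the final guess make `c + n` rounds.
  strategy , subst (WinsWithin strategy) (sym (trans (ℕₚ.+-suc c (suc p)) (cong suc (ℕₚ.+-suc c p)))) (wins guess-last)
  where open Codebreaker c p d k≤

theorem3 : (n c b : ℕ) → 1 ≤ n → 1 ≤ c → 1 ≤ b → b < n →
    (Σ (Strategy (c * n + b) n) λ s → WinsWithin s (c + n))
    × (∀ (m : ℕ) (s : Strategy (c * n + b) n) → WinsWithin s m → c + n ∸ 1 ≤ m)
theorem3 (suc n) (suc c) (suc b) _ _ _ b<n =
  -- The bounds on `b` force at least two positions.
  upper-bound (suc c) (suc n) zero (ℕₚ.≤-trans (s≤s (s≤s z≤n)) b<n)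
    (ℕₚ.≤-trans (ℕₚ.+-monoʳ-≤ (suc c * suc n) (ℕₚ.<⇒≤ b<n)) (ℕₚ.≤-reflexive (ℕₚ.+-comm _ (suc n)))) ,
  -- The matched `c` is one less than that of the statement, hence the bound `c + n ∸ 1` there.
  λ m s → lower-bound c s m (ℕₚ.m≤m+n _ (suc b))
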